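{- Let $a,b,c,d\in Act$ be pairwise distinct actions, and let $p=abc+a(bc+d)+ab$ and $q=a(bc+d)+ab$. Then $p$ and $q$ are not possible-worlds equivalent, but they satisfy exactly the same formulas of $\mathcal{L}_{PW}$. On the other hand, the formula $\varphi=a(\neg d\top\wedge bc\top)$ satisfies $p\models\varphi$ and $q\not\models\varphi$.
   Context: BCCSP processes: $p::=\mathbf{0}\mid ap\mid p+q$, with the usual transitions $ap\xrightarrow{a}p$, and $p+q\xrightarrow{a}r$ iff $p\xrightarrow{a}r$ or $q\xrightarrow{a}r$; trailing $\mathbf 0$'s are omitted (e.g. $abc=a(b(c\mathbf{0}))$). $I(p)=\{a\in Act\mid p\xrightarrow{a}\}$. Hennessy-Milner formulas: $\varphi::=\bigwedge_{i\in I}\varphi_i\mid a\varphi\mid\neg\varphi$, where $p\models a\varphi$ iff $p\xrightarrow{a}q$ and $q\models\varphi$ for some $q$, and conjunction and negation have their usual meaning; $\top$ is the empty conjunction. $\mathcal{L}_{PW}$ (the characterization of possible worlds semantics given in van Glabbeek's classic spectrum) is the least set of formulas such that: for each $X\subseteq Act$, $\bigwedge_{a\in X}a\top\wedge\bigwedge_{a\notin X}\neg a\top\in\mathcal{L}_{PW}$; and if $X\subseteq Act$ and $\varphi_a\in\mathcal{L}_{PW}$ for all $a\in X$, then $\bigwedge_{a\in X}a\varphi_a\in\mathcal{L}_{PW}$. Possible worlds: a ready simulation is a relation $R$ such that $sRt$ implies $I(s)=I(t)$ and, whenever $s\xrightarrow{a}s'$, there is $t'$ with $t\xrightarrow{a}t'$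 and $s'Rt'$. A process $s$ is deterministic if every state reachable from $s$ has at most one $a$-successor for each $a\in Act$. A possible world of $p$ is a deterministic process $s$ such that $sRp$ for some ready simulation $R$. Two processes are possible-worlds equivalent if they have the same possible worlds. -}

module Defs where

open import Data.Bool.Base using (Bool; if_then_else_)
open import Data.Empty using (⊥; ⊥-elim)
open import Data.Product.Base using (Σ; ∃-syntax; _×_; proj₁)
open import Function.Base using (_∘_)
open import Function.Bundles using (_⇔_)
open import Level using (0ℓ) renaming (suc to lsuc)
open import Relation.Binary.Construct.Closure.ReflexiveTransitive using (Star)
open import Relation.Binary.Core using (Rel)
open import Relation.Binary.PropositionalEquality.Core using (_≡_)
open import Relation.Nullary.Negation.Core using (¬_)
open import Relation.Unary using (Pred; _∈_; _≐_; ∁)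

private
  variable
    Act : Set

infixr 8 _∙_
infixl 6 _+_

data Proc (Act : Set) : Set where
  𝟎   : Proc Act
  _∙_ : Act → Proc Act → Proc Act
  _+_ : Proc Act → Proc Act → Proc Act

infix 4 _-[_]→_

data _-[_]→_ {Act : Set} : Proc Act → Act → Proc Act → Set where
  prefix : ∀ {a p} → a ∙ p -[ a ]→ p
  left   : ∀ {a p q r} → p -[ a ]→ r → p + q -[ a ]→ r
  right  : ∀ {a p q r} → q -[ a ]→ r → p + q -[ a ]→ r

I : Proc Act → Pred Act 0ℓ
I p a = ∃[ q ] p -[ a ]→ q

infixr 8 ⟨_⟩_
infixr 8 ~_
infixr 7 _∧_

data Formula (Act : Set) : Set₁ where
  ⋀    : {J : Set} → (J → Formula Act) → Formula Act
  ⟨_⟩_ : Act → Formula Act → Formula Act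
  ~_   : Formula Act → Formula Act

⊤ᶠ : Formula Act
⊤ᶠ = ⋀ {J = ⊥} ⊥-elim

_∧_ : Formula Act → Formula Act → Formula Act
φ ∧ ψ = ⋀ {J = Bool} (λ i → if i then φ else ψ)

-- The conjunction of the φ a with a ∈ X. As φ is a function of a alone, and not
-- of a proof of a ∈ X, there is exactly one conjunct formula for each a ∈ X;
-- the values of φ outside X are irrelevant.
⋀[_] : Pred Act 0ℓ → (Act → Formula Act) → Formula Act
⋀[ X ] φ = ⋀ {J = Σ _ X} (φ ∘ proj₁)

infix 4 _⊨_

_⊨_ : Proc Act → Formula Act → Set
p ⊨ ⋀ φ     = ∀ i → p ⊨ φ i
p ⊨ ⟨ a ⟩ φ = ∃[ q ] (p -[ a ]→ q × q ⊨ φ)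
p ⊨ ~ φ     = ¬ (p ⊨ φ)

data 𝓛PW {Act : Set} : Pred (Formula Act) (lsuc 0ℓ) where
  ready : (X : Pred Act 0ℓ) →
          (⋀[ X ] (λ a → ⟨ a ⟩ ⊤ᶠ) ∧ ⋀[ ∁ X ] (λ a → ~ ⟨ a ⟩ ⊤ᶠ)) ∈ 𝓛PW
  conj  : (X : Pred Act 0ℓ) (φ : Act → Formula Act) →
          (∀ a → a ∈ X → φ a ∈ 𝓛PW) →
          ⋀[ X ] (λ a → ⟨ a ⟩ φ a) ∈ 𝓛PW

IsReadySimulation : Rel (Proc Act) 0ℓ → Set
IsReadySimulation R = ∀ {s t} → R s t →
  I s ≐ I t ×
  (∀ {a s′} → s -[ a ]→ s′ → ∃[ t′ ] (t -[ a ]→ t′ × R s′ t′))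

Reachable : Rel (Proc Act) 0ℓ
Reachable = Star (λ s t → ∃[ a ] s -[ a ]→ t)

Deterministic : Proc Act → Set
Deterministic s = ∀ {t} → Reachable s t →
  ∀ {a u v} → t -[ a ]→ u → t -[ a ]→ v → u ≡ v

_IsPossibleWorldOf_ : Proc Act → Proc Act → Set₁
s IsPossibleWorldOf p = Deterministic s × ∃[ R ] (IsReadySimulation R × R s p)

PossibleWorldsEquivalent : Proc Act → Proc Act → Set₁
PossibleWorldsEquivalent p q = ∀ s → s IsPossibleWorldOf p ⇔ s IsPossibleWorldOf q

{-# OPTIONS --safe #-}
-- A formula of 𝓛PW constrains the refusals of a state only by a formula
-- that fixes the whole menu and says nothing about what comes afterwards. So if
-- bc satisfies a formula of 𝓛PW, then either the formula is such a menu, and b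
-- satisfies it too, or it is a conjunction of diamonds, and bc + d satisfies it
-- too. Hence the summand abc of p cannot be detected, although abc itself is a
-- possible world of p and not of q.
module Submission where

open import Defs
open import Data.Bool.Base using (true; false)
open import Data.List.Base using (_∷_; [])
open import Data.List.Relation.Unary.All using (_∷_; [])
open import Data.List.Relation.Unary.AllPairs using (_∷_)
open import Data.List.Relation.Unary.Unique.Propositional using (Unique)
open import Data.Product.Base using (_×_; _,_; proj₁; proj₂)
open import Data.Sum.Base using (_⊎_; inj₁; inj₂)
open import Function.Base using (id)
open import Function.Bundles using (_⇔_; mk⇔; Equivalence)
open import Level using (0ℓ)
open import Relation.Binary.Construct.Closure.ReflexiveTransitive using (ε; _◅_)
open import Relation.Binary.Core using (Rel)
open import Relation.Binary.PropositionalEquality.Core using (refl)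
open import Relation.Nullary.Negation.Core using (¬_)
open import Relation.Unary using (Pred; _∈_; _≐_; ∁)

private
  variable
    Act : Set
    a b : Act
    q r s t : Proc Act
    φ : Formula Act

∙-I-≐ : I (b ∙ s) ≐ I (b ∙ t)
∙-I-≐ = (λ { (_ , prefix) → _ , prefix }) , λ { (_ , prefix) → _ , prefix }

𝟎-deterministic : Deterministic (𝟎 {Act})
𝟎-deterministic ε ()
𝟎-deterministic ((_ , ()) ◅ _)

∙-deterministic : Deterministic s → Deterministic (b ∙ s)
∙-deterministic det ε                       prefix prefix = refl
∙-deterministic det ((_ , prefix) ◅ steps) = det steps

-- Every state satisfies `⊤ᶠ`, so only the existence of a first step matters and any derivative of
-- the other process serves as witness.
ready-resp-I : (X : Pred Act 0ℓ) → I s ≐ I t →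
  let ψ = ⋀[ X ] (λ a → ⟨ a ⟩ ⊤ᶠ) ∧ ⋀[ ∁ X ] (λ a → ~ ⟨ a ⟩ ⊤ᶠ)
  in s ⊨ ψ → t ⊨ ψ
ready-resp-I X (I⊆ , I⊇) s⊨ψ true (a , a∈X) =
  let _ , step , _ = s⊨ψ true (a , a∈X)
      _ , step′    = I⊆ (_ , step)
  in _ , step′ , λ ()
ready-resp-I X (I⊆ , I⊇) s⊨ψ false (a , a∉X) (_ , step , _) =
  let _ , step′ = I⊇ (_ , step)
  in s⊨ψ false (a , a∉X) (_ , step′ , λ ())

-- The outermost constructor decides, without induction: a conjunction of diamonds keeps its
-- witnesses when a summand is added.
same-menu-or-extension : I s ≐ I t → φ ∈ 𝓛PW → s ⊨ φ → (s + r) ⊨ φ ⊎ t ⊨ φ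
same-menu-or-extension I≐ (ready X)    s⊨φ = inj₂ (ready-resp-I X I≐ s⊨φ)
same-menu-or-extension I≐ (conj X φ _) s⊨φ = inj₁ λ i →
  let u , step , u⊨ = s⊨φ i in u , left step , u⊨

I-absorb : I (a ∙ s + a ∙ r + a ∙ t) ≐ I (a ∙ r + a ∙ t)
I-absorb =
  (λ { (_ , left (left prefix))  → _ , left prefix
     ; (_ , left (right prefix)) → _ , left prefix
     ; (_ , right prefix)        → _ , right prefix }) ,
  (λ { (_ , left prefix)  → _ , left (right prefix)
     ; (_ , right prefix) → _ , right prefix })

𝓛PW-absorb : I s ≐ I t → φ ∈ 𝓛PW →
  (a ∙ s + a ∙ (s + r) + a ∙ t) ⊨ φ ⇔ (a ∙ (s + r) + a ∙ t) ⊨ φ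
𝓛PW-absorb I≐ (ready X) =
  mk⇔ (ready-resp-I X I-absorb)
      (ready-resp-I X (proj₂ I-absorb , proj₁ I-absorb))
𝓛PW-absorb {s = s} {t = t} {a = a} {r = r} I≐ (conj X φ φ∈) =
  mk⇔ (λ p⊨ i → to (proj₂ i) (p⊨ i)) (λ q⊨ i → from (q⊨ i))
  where
  p′ = a ∙ s + a ∙ (s + r) + a ∙ t
  q′ = a ∙ (s + r) + a ∙ t

  to : ∀ {x} → x ∈ X → p′ ⊨ ⟨ x ⟩ φ x → q′ ⊨ ⟨ x ⟩ φ x
  -- The step to `s` is the only one that `q′` lacks. The choice of its replacement, `s + r` or `t`,
  -- depends on the form of `φ x`.
  to x∈X (_ , left (left prefix) , s⊨) with same-menu-or-extension I≐ (φ∈ _ x∈X) s⊨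
  ... | inj₁ s+r⊨ = _ , left prefix , s+r⊨
  ... | inj₂ t⊨   = _ , right prefix , t⊨
  to x∈X (_ , left (right step) , u⊨) = _ , left step , u⊨
  to x∈X (_ , right step , u⊨)        = _ , right step , u⊨

  from : ∀ {x} → q′ ⊨ ⟨ x ⟩ φ x → p′ ⊨ ⟨ x ⟩ φ x
  from (_ , left step , u⊨)  = _ , left (right step) , u⊨
  from (_ , right step , u⊨) = _ , right step , u⊨

-- A summand and the whole sum can differ only before the first move; afterwards both are in one
-- state, so `same` closes the relation under steps.
data Summand {Act : Set} : Rel (Proc Act) 0ℓ where
  same    : Summand s s
  summand : I s ≐ I (s + q + r) → Summand s (s + q + r)

Summand-isReadySimulation : IsReadySimulation (Summand {Act})
Summand-isReadySimulation same         = (id , id) , λ step → _ , step , same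
Summand-isReadySimulation (summand I≐) = I≐ , λ step → _ , left (left step) , same

possibleWorld-summand : Deterministic s → I s ≐ I (s + q + r) →
  s IsPossibleWorldOf (s + q + r)
possibleWorld-summand det I≐ = det , Summand , Summand-isReadySimulation , summand I≐

mainTheorem4 : (Act : Set) (a b c d : Act) → Unique (a ∷ b ∷ c ∷ d ∷ []) →
    let p = a ∙ b ∙ c ∙ 𝟎 + a ∙ (b ∙ c ∙ 𝟎 + d ∙ 𝟎) + a ∙ b ∙ 𝟎
        q = a ∙ (b ∙ c ∙ 𝟎 + d ∙ 𝟎) + a ∙ b ∙ 𝟎
        φ = ⟨ a ⟩ (~ ⟨ d ⟩ ⊤ᶠ ∧ ⟨ b ⟩ ⟨ c ⟩ ⊤ᶠ)
    in ¬ PossibleWorldsEquivalent p q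
       × (∀ ψ → ψ ∈ 𝓛PW → (p ⊨ ψ ⇔ q ⊨ ψ))
       × p ⊨ φ
       × ¬ (q ⊨ φ)
mainTheorem4 Act a b c d (_ ∷ (_ ∷ b≢d ∷ []) ∷ _) =
  (λ p≈q → abc-not-world (Equivalence.to (p≈q abc) abc-world)) ,
  -- Here `s` is bc, `r` is d and `t` is b; bc and b both offer exactly b.
  (λ _ → 𝓛PW-absorb ∙-I-≐) ,
  (_ , left (left prefix) ,
    λ { true  (_ , step , _) → bc-refuses-d step
      ; false → _ , prefix , _ , prefix , λ () }) ,
  -- Of the two derivatives of q, bc + d can do d, and b cannot do c after b.
  λ { (_ , left prefix , q⊨)  → q⊨ true (_ , right prefix , λ ())
    ; (_ , right prefix , q⊨) → b-then-c (q⊨ false) }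
  where
  abc = a ∙ b ∙ c ∙ 𝟎

  bc-refuses-d : ∀ {u} → ¬ (b ∙ c ∙ 𝟎 -[ d ]→ u)
  bc-refuses-d prefix = b≢d refl

  b-then-c : ¬ (b ∙ 𝟎 ⊨ ⟨ b ⟩ ⟨ c ⟩ ⊤ᶠ)
  b-then-c (_ , prefix , _ , () , _)

  abc-world : abc IsPossibleWorldOf (abc + a ∙ (b ∙ c ∙ 𝟎 + d ∙ 𝟎) + a ∙ b ∙ 𝟎)
  abc-world = possibleWorld-summand
    (∙-deterministic (∙-deterministic (∙-deterministic 𝟎-deterministic)))
    ( (λ { (_ , prefix) → _ , left (left prefix) })
    , (λ { (_ , left (left prefix))  → _ , prefix
         ; (_ , left (right prefix)) → _ , prefix
         ; (_ , right prefix)        → _ , prefix }))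

  abc-not-world : ¬ (abc IsPossibleWorldOf (a ∙ (b ∙ c ∙ 𝟎 + d ∙ 𝟎) + a ∙ b ∙ 𝟎))
  abc-not-world (_ , R , sim , Rabc) with proj₂ (sim Rabc) prefix
  -- Equal menus of bc and bc + d would give bc a d-step.
  ... | _ , left prefix , Rbc =
    let _ , step = proj₂ (proj₁ (sim Rbc)) (_ , right prefix)
    in bc-refuses-d step
  -- The menus of bc and b agree; the mismatch comes one step later, where c is compared with `𝟎`.
  ... | _ , right prefix , Rbc with proj₂ (sim Rbc) prefix
  ...   | _ , prefix , Rc with proj₁ (proj₁ (sim Rc)) (_ , prefix)
  ...     | _ , ()
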